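{- Let $\mathcal{A}$ be a timed automaton with syntactically bounded subtraction. Then the smallest reduced $\mathcal{G}$-map $(\mathcal{G}(q))_{q\in Q}$ of $\mathcal{A}$ is finite, i.e. $\mathcal{G}(q)$ is a finite set for every state $q$ of $\mathcal{A}$.
   Context: Clocks and constraints. $X$ is a finite set of clocks; a valuation is a map $v:X\to\mathbb{R}_{\ge 0}$; $\mathbb{V}$ is the set of valuations; $(v+\delta)(x)=v(x)+\delta$. Below $\triangleleft,\triangleleft_1$ each denote one of $<,\le$ (not necessarily the same). An atomic constraint is a non-diagonal constraint $x\triangleleft c$ or $c\triangleleft x$, a diagonal constraint $x-y\triangleleft c$ or $c\triangleleft x-y$ (with $x,y\in X$, $c\in\mathbb{N}$), or one of $\top$ (true), $\bot$ (false). A constraint (guard) is a finite conjunction of atomic constraints; "$g$ contains $\psi$" means $\psi$ is one of the atomic conjuncts of $g$. Updates. An update $up$ assigns to each clock $x$ an expression $up_x$ which is either $c$ with $c\in\mathbb{N}$ or $y+d$ with $y\in X$ (possibly $y=x$), $d\in\mathbb{Z}$. For a valuation $v$, $v(up_x)$ is $c$ or $v(y)+d$ respectively; $up(v)$ is defined iff $v(up_x)\ge 0$ for all $x$, and then $up(v)(x)=v(up_x)$. UTA. An updatable timed automaton (UTA) $\mathcal{A}=(Q,X,q_0,T,F)$ has a finite set $Q$ of states, a finite set $X$ of clocks, initial state $q_0$, finite set $T$ of transitions $(q,g,up,q')$ (source $q$, guard $g$, update $up$, target $q'$), and accepting states $F\subseteq Q$. Inverse update. $up^{ -1}(\varphi)$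 is obtained from $\varphi$ by simultaneously substituting $up_x$ for every clock $x$, and rewriting the result into an equivalent (over $\mathbb{V}$) constraint built from atomic constraints of the forms $x\triangleleft c$, $c\triangleleft x$, $x-y\triangleleft c$, $c\triangleleft x-y$ (with $x,y\in X$, $c\in\mathbb{N}$), $\top$, $\bot$: constants are collected on one side; for $c>0$, $x-y\triangleleft -c$ is rewritten $c\triangleleft y-x$ and $-c\triangleleft x-y$ is rewritten $y-x\triangleleft c$; results equivalent over $\mathbb{V}$ to true or false (e.g. $0\le x$, or $x\le -1$) are identified with $\top$, resp. $\bot$. Pre. For a guard $g$, update $up$ and atomic constraint $\varphi$, the atomic constraint $\mathrm{pre}(\varphi,g,up)$ is defined by: (1) if $up^{ -1}(\varphi)$ is $x\triangleleft d$ and $g$ contains some $x\triangleleft_1 c$, then it is $\top$; (2) if $up^{ -1}(\varphi)$ is $d\triangleleft x$ and $g$ contains some $x\triangleleft_1 c$ with $c<d$, then it is $c\le x$ (if several such $c$ exist, one is fixed); (3) if $up^{ -1}(\varphi)$ is $x-y\triangleleft d$ or $d\triangleleft x-y$, and $g$ contains some $x\triangleleft_1 c$ with $c<d$, or some $x-y\triangleleft_1 c$ with $c<d$, or some $e\triangleleft_1 x-y$ with $d<e$, then it is $\top$; in all other cases it is $up^{ -1}(\varphi)$. Reduced $\mathcal{G}$-map. A reduced $\mathcal{G}$-map for $\mathcal{A}$ is a family $(\mathcal{G}(q))_{q\in Q}$ of sets of atomic constraints such that for every transition $(q,g,up,q')\in T$: every atomic constraint of $g$ belongs to $\mathcal{G}(q)$;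 $\mathrm{pre}(0\le x,g,up)\in\mathcal{G}(q)$ for every $x\in X$; and $\mathrm{pre}(\varphi,g,up)\in\mathcal{G}(q)$ for every $\varphi\in\mathcal{G}(q')$. Reduced $\mathcal{G}$-maps are closed under pointwise intersection, so there is a smallest one for pointwise inclusion. Timed automaton with syntactically bounded subtraction. A timed automaton with subtraction is a UTA in which every atomic update is of the form $x:=0$ or $x:=x-c$ with $c\ge 0$ (guards may contain diagonal and non-diagonal constraints). It has syntactically bounded subtraction if for every transition $(q,g,up,q')$ and clock $x$: if $up_x=x-c$ with $c>0$, then $g$ contains an upper bound constraint $x\triangleleft c'$ for some $c'\in\mathbb{N}$. -}

module Defs where

open import Level using (0ℓ)
open import Data.Bool using (Bool; if_then_else_)
open import Data.Fin using (Fin)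
open import Data.Fin.Properties using (_≟_)
open import Data.Fin.Subset using (Subset)
open import Data.Integer using (ℤ; +_; -[1+_]; -_; _+_; _-_)
import Data.Integer as ℤ
open import Data.List using (List)
open import Data.List.Membership.Propositional using (_∈_)
open import Data.List.Relation.Unary.Any using (Any; any?; satisfied)
open import Data.Nat using (ℕ; suc; _<_; _<?_)
open import Data.Product using (∃-syntax; _×_; _,_)
open import Data.Sum using (_⊎_)
open import Function.Bundles using (_⇔_)
open import Relation.Binary.PropositionalEquality using (_≡_; refl)
open import Relation.Nullary.Decidable using (Dec; yes; no; does; map′; _×-dec_)
open import Relation.Unary using (Pred; Decidable; _⊆_)

data Rel : Set where
  lt le : Rel

-- Over the clock set X = Fin n and with ◁ : Rel,
--   upper x ◁ c        is  x ◁ c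
--   lower c ◁ x        is  c ◁ x
--   diagUpper x y ◁ c  is  x - y ◁ c
--   diagLower c ◁ x y  is  c ◁ x - y
data Atomic (n : ℕ) : Set where
  upper     : Fin n → Rel → ℕ → Atomic n
  lower     : ℕ → Rel → Fin n → Atomic n
  diagUpper : Fin n → Fin n → Rel → ℕ → Atomic n
  diagLower : ℕ → Rel → Fin n → Fin n → Atomic n
  ⊤ᶜ ⊥ᶜ     : Atomic n

Guard : ℕ → Set
Guard n = List (Atomic n)

data Expr (n : ℕ) : Set where
  const : ℕ → Expr n
  _⊕_   : Fin n → ℤ → Expr n

Update : ℕ → Set
Update n = Fin n → Expr n

record Transition (k n : ℕ) : Set where
  field
    source : Fin k
    guard  : Guard n
    update : Update n
    target : Fin k

record UTA : Set where
  field
    states      : ℕ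
    clocks      : ℕ
    initial     : Fin states
    transitions : List (Transition states clocks)
    accepting   : Subset states

-- Inverse update.  The functions truth, upperᶻ, lowerᶻ, diagUpperᶻ and
-- diagLowerᶻ rewrite an atomic constraint with an arbitrary integer constant
-- into an atomic constraint that is equivalent over non-negative valuations.

truth : {n : ℕ} → ℤ → Rel → ℤ → Atomic n
truth a lt b = if does (a ℤ.<? b) then ⊤ᶜ else ⊥ᶜ
truth a le b = if does (a ℤ.≤? b) then ⊤ᶜ else ⊥ᶜ

upperᶻ : {n : ℕ} → Fin n → Rel → ℤ → Atomic n
upperᶻ x lt (+ 0)       = ⊥ᶜ
upperᶻ x lt (+ suc c) = upper x lt (suc c)
upperᶻ x le (+ c)       = upper x le c
upperᶻ x ◁  -[1+ _ ]    = ⊥ᶜ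

lowerᶻ : {n : ℕ} → ℤ → Rel → Fin n → Atomic n
lowerᶻ (+ c)       lt x = lower c lt x
lowerᶻ (+ 0)       le x = ⊤ᶜ
lowerᶻ (+ suc c) le x = lower (suc c) le x
lowerᶻ -[1+ _ ]    ◁  x = ⊤ᶜ

diagUpperᶻ : {n : ℕ} → Fin n → Fin n → Rel → ℤ → Atomic n
diagUpperᶻ x y ◁ c with x ≟ y | c
... | yes _ | _        = truth (+ 0) ◁ c
... | no  _ | + d      = diagUpper x y ◁ d
... | no  _ | -[1+ d ] = diagLower (suc d) ◁ y x

diagLowerᶻ : {n : ℕ} → ℤ → Rel → Fin n → Fin n → Atomic n
diagLowerᶻ c ◁ x y with x ≟ y | c
... | yes _ | _        = truth c ◁ (+ 0)
... | no  _ | + d      = diagLower d ◁ x y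
... | no  _ | -[1+ d ] = diagUpper y x ◁ (suc d)

infix 8 _⁻¹[_]

_⁻¹[_] : {n : ℕ} → Update n → Atomic n → Atomic n
up ⁻¹[ upper x ◁ c ] with up x
... | const a = truth (+ a) ◁ (+ c)
... | z ⊕ d   = upperᶻ z ◁ (+ c - d)
up ⁻¹[ lower c ◁ x ] with up x
... | const a = truth (+ c) ◁ (+ a)
... | z ⊕ d   = lowerᶻ (+ c - d) ◁ z
up ⁻¹[ diagUpper x y ◁ c ] with up x | up y
... | const a | const b = truth (+ a - + b) ◁ (+ c)
... | z ⊕ d   | const b = upperᶻ z ◁ (+ c - d + + b)
... | const a | w ⊕ e   = lowerᶻ (+ a - e - + c) ◁ w
... | z ⊕ d   | w ⊕ e   = diagUpperᶻ z w ◁ (+ c - d + e)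
up ⁻¹[ diagLower c ◁ x y ] with up x | up y
... | const a | const b = truth (+ c) ◁ (+ a - + b)
... | z ⊕ d   | const b = lowerᶻ (+ c - d + + b) ◁ z
... | const a | w ⊕ e   = upperᶻ w ◁ (+ a - e - + c)
... | z ⊕ d   | w ⊕ e   = diagLowerᶻ (+ c - d + e) ◁ z w
up ⁻¹[ ⊤ᶜ ] = ⊤ᶜ
up ⁻¹[ ⊥ᶜ ] = ⊥ᶜ

-- "g contains ..." is rendered as Any applied to one of the following.

data UpperBound {n : ℕ} (x : Fin n) : Pred (Atomic n) 0ℓ where
  upperBound : ∀ {◁ c} → UpperBound x (upper x ◁ c)

data UpperBelow {n : ℕ} (x : Fin n) (d : ℕ) : Pred (Atomic n) 0ℓ where
  upperBelow : ∀ {◁} c → c < d → UpperBelow x d (upper x ◁ c)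

data DiagPruned {n : ℕ} (x y : Fin n) (d : ℕ) : Pred (Atomic n) 0ℓ where
  byUpper     : ∀ {◁ c} → c < d → DiagPruned x y d (upper x ◁ c)
  byDiagUpper : ∀ {◁ c} → c < d → DiagPruned x y d (diagUpper x y ◁ c)
  byDiagLower : ∀ {◁ e} → d < e → DiagPruned x y d (diagLower e ◁ x y)

upperBound? : {n : ℕ} (x : Fin n) → Decidable (UpperBound x)
upperBound? x (upper y ◁ c) = map′ (λ { refl → upperBound }) (λ { upperBound → refl }) (x ≟ y)
upperBound? x (lower _ _ _)       = no λ ()
upperBound? x (diagUpper _ _ _ _) = no λ ()
upperBound? x (diagLower _ _ _ _) = no λ ()
upperBound? x ⊤ᶜ                  = no λ ()
upperBound? x ⊥ᶜ                  = no λ ()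

upperBelow? : {n : ℕ} (x : Fin n) (d : ℕ) → Decidable (UpperBelow x d)
upperBelow? x d (upper y ◁ c) =
  map′ (λ { (refl , c<d) → upperBelow c c<d }) (λ { (upperBelow _ c<d) → refl , c<d })
       (x ≟ y ×-dec c <? d)
upperBelow? x d (lower _ _ _)       = no λ ()
upperBelow? x d (diagUpper _ _ _ _) = no λ ()
upperBelow? x d (diagLower _ _ _ _) = no λ ()
upperBelow? x d ⊤ᶜ                  = no λ ()
upperBelow? x d ⊥ᶜ                  = no λ ()

diagPruned? : {n : ℕ} (x y : Fin n) (d : ℕ) → Decidable (DiagPruned x y d)
diagPruned? x y d (upper z ◁ c) =
  map′ (λ { (refl , c<d) → byUpper c<d }) (λ { (byUpper c<d) → refl , c<d })
       (x ≟ z ×-dec c <? d)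
diagPruned? x y d (diagUpper z w ◁ c) =
  map′ (λ { (refl , refl , c<d) → byDiagUpper c<d }) (λ { (byDiagUpper c<d) → refl , refl , c<d })
       (x ≟ z ×-dec y ≟ w ×-dec c <? d)
diagPruned? x y d (diagLower e ◁ z w) =
  map′ (λ { (refl , refl , d<e) → byDiagLower d<e }) (λ { (byDiagLower d<e) → refl , refl , d<e })
       (x ≟ z ×-dec y ≟ w ×-dec d <? e)
diagPruned? x y d (lower _ _ _) = no λ ()
diagPruned? x y d ⊤ᶜ            = no λ ()
diagPruned? x y d ⊥ᶜ            = no λ ()

-- Which of the conjuncts x ◁₁ c with c < d of g is used in the second case
-- of pre φ g up is left open: a Selection picks one whenever there is one.
Selection : ℕ → Set
Selection n = (φ : Atomic n) (g : Guard n) (up : Update n) (x : Fin n) (d : ℕ) →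
  Any (UpperBelow x d) g → Any (UpperBelow x d) g

selected : {n : ℕ} {x : Fin n} {d : ℕ} {g : Guard n} → Any (UpperBelow x d) g → ℕ
selected p with satisfied p
... | _ , upperBelow c _ = c

pre : {n : ℕ} → Selection n → Atomic n → Guard n → Update n → Atomic n
pre sel φ g up with up ⁻¹[ φ ]
... | upper x ◁ d       = if does (any? (upperBound? x) g) then ⊤ᶜ else upper x ◁ d
... | diagUpper x y ◁ d = if does (any? (diagPruned? x y d) g) then ⊤ᶜ else diagUpper x y ◁ d
... | diagLower d ◁ x y = if does (any? (diagPruned? x y d) g) then ⊤ᶜ else diagLower d ◁ x y
... | ⊤ᶜ                = ⊤ᶜ
... | ⊥ᶜ                = ⊥ᶜ
... | lower d ◁ x with any? (upperBelow? x d) g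
...   | yes p = lower (selected (sel φ g up x d p)) le x
...   | no  _ = lower d ◁ x

module _ (𝒜 : UTA) where
  open UTA 𝒜
  open Transition

  ConstraintMap : Set₁
  ConstraintMap = Fin states → Pred (Atomic clocks) 0ℓ

  record IsReducedMap (sel : Selection clocks) (G : ConstraintMap) : Set where
    field
      guards      : ∀ {t} → t ∈ transitions → ∀ {φ} → φ ∈ guard t → G (source t) φ
      nonNegative : ∀ {t} → t ∈ transitions → ∀ x →
                    G (source t) (pre sel (lower 0 le x) (guard t) (update t))
      propagates  : ∀ {t} → t ∈ transitions → ∀ {φ} → G (target t) φ →
                    G (source t) (pre sel φ (guard t) (update t))

  record IsSmallestReducedMap (sel : Selection clocks) (G : ConstraintMap) : Set₁ where
    field
      isReduced : IsReducedMap sel G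
      smallest  : ∀ {H} → IsReducedMap sel H → ∀ q → G q ⊆ H q

  data LeastMap (sel : Selection clocks) : ConstraintMap where
    guards      : ∀ {t} → t ∈ transitions → ∀ {φ} → φ ∈ guard t → LeastMap sel (source t) φ
    nonNegative : ∀ {t} → t ∈ transitions → ∀ x →
                  LeastMap sel (source t) (pre sel (lower 0 le x) (guard t) (update t))
    propagates  : ∀ {t} → t ∈ transitions → ∀ {φ} → LeastMap sel (target t) φ →
                  LeastMap sel (source t) (pre sel φ (guard t) (update t))

  -- IsSmallestReducedMap is inhabited for every automaton and selection.
  leastMap-isSmallest : (sel : Selection clocks) → IsSmallestReducedMap sel (LeastMap sel)
  leastMap-isSmallest sel = record
    { isReduced = record { guards = guards ; nonNegative = nonNegative ; propagates = propagates }
    ; smallest  = λ R _ → fold R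
    }
    where
    fold : ∀ {H} → IsReducedMap sel H → ∀ {q φ} → LeastMap sel q φ → H q φ
    fold R (guards t∈T φ∈g)     = IsReducedMap.guards R t∈T φ∈g
    fold R (nonNegative t∈T x)  = IsReducedMap.nonNegative R t∈T x
    fold R (propagates t∈T φ∈G) = IsReducedMap.propagates R t∈T (fold R φ∈G)

  record IsTimedAutomatonWithSubtraction : Set where
    field
      resetOrSubtract : ∀ {t} → t ∈ transitions → ∀ x →
                        update t x ≡ const 0 ⊎ ∃[ c ] update t x ≡ x ⊕ (- (+ c))

  record HasSyntacticallyBoundedSubtraction : Set where
    field
      isTimedAutomatonWithSubtraction : IsTimedAutomatonWithSubtraction
      bounded : ∀ {t} → t ∈ transitions → ∀ x c → 0 < c → update t x ≡ x ⊕ (- (+ c)) →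
                ∃[ ◁ ] ∃[ c′ ] upper x ◁ c′ ∈ guard t

Finite : {A : Set} → Pred A 0ℓ → Set
Finite {A} P = ∃[ xs ] (∀ (a : A) → P a ⇔ a ∈ xs)

{-# OPTIONS --safe #-}
module Submission where

-- If N bounds the constants of all guards, then the constraints with constant at
-- most N already form a reduced map: up⁻¹ can raise a constant only by moving a
-- clock x past a subtraction, and then x is bounded above by some c ≤ N in the
-- guard, so that pre prunes a constant beyond N.  The smallest map therefore lies
-- in a finite set, and saturating within that set lists it exactly.

open import Defs

open import Data.Bool using (Bool; true; false)
import Data.Bool.Properties as Bool
open import Data.Fin using (Fin)
import Data.Fin.Properties as Fin
open import Data.Integer using (+_; -[1+_]; -_; +≤+; _≤?_; _<?_)
import Data.Integer as ℤ
import Data.Integer.Properties as ℤ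
open import Data.List using (List; []; _∷_; _++_; map; concatMap; filter; length; allFin; upTo; cartesianProduct)
open import Data.List.Extrema.Nat using (max; xs≤max)
open import Data.List.Membership.Propositional using (_∈_; find; lose)
open import Data.List.Membership.Propositional.Properties
import Data.List.Membership.DecPropositional as DecMembership
open import Data.List.Properties using (filter-notAll)
open import Data.List.Relation.Unary.All as All using (All; all?)
import Data.List.Relation.Unary.All.Properties as All
open import Data.List.Relation.Unary.Any as Any using (Any; here; there; any?; satisfied)
open import Data.Nat using (ℕ; zero; suc; _≤_; _<_; z≤n; s≤s)
open import Data.Nat.Induction using (<-wellFounded)
import Data.Nat.Properties as ℕ
open import Data.Product using (∃-syntax; _×_; _,_; proj₁; proj₂; uncurry)
import Data.Product.Properties as Product
open import Data.Sum using (_⊎_; inj₁; inj₂; [_,_]′)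
import Data.Sum.Properties as Sum
open import Data.Unit using (⊤)
open import Function using (_∘_)
open import Function.Bundles using (mk⇔; mk↣)
open import Induction.WellFounded using (Acc; acc)
open import Level using (0ℓ)
open import Relation.Binary.Definitions using (DecidableEquality)
open import Relation.Binary.PropositionalEquality using (_≡_; refl; sym; trans; cong; subst)
open import Relation.Nullary.Decidable using (yes; no; ¬?; via-injection)
open import Relation.Nullary.Negation using (contradiction)
open import Relation.Unary using (Pred; Decidable)

-- Decidable equality of atomic constraints.

_≟ᴿ_ : DecidableEquality Rel
lt ≟ᴿ lt = yes refl
lt ≟ᴿ le = no λ ()
le ≟ᴿ lt = no λ ()
le ≟ᴿ le = yes refl

-- A sum of products, so that equality and enumeration both come from generic constructions. The
-- `Bool` leading a tuple is `true` for upper and `false` for lower constraints.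
Code : ℕ → Set
Code n = Bool ⊎ (Bool × Rel × ℕ × Fin n) ⊎ (Bool × Rel × ℕ × Fin n × Fin n)

encode : ∀ {n} → Atomic n → Code n
encode ⊤ᶜ                  = inj₁ true
encode ⊥ᶜ                  = inj₁ false
encode (upper x ◁ c)       = inj₂ (inj₁ (true , ◁ , c , x))
encode (lower c ◁ x)       = inj₂ (inj₁ (false , ◁ , c , x))
encode (diagUpper x y ◁ c) = inj₂ (inj₂ (true , ◁ , c , x , y))
encode (diagLower c ◁ x y) = inj₂ (inj₂ (false , ◁ , c , x , y))

decode : ∀ {n} → Code n → Atomic n
decode (inj₁ true)                           = ⊤ᶜ
decode (inj₁ false)                          = ⊥ᶜ
decode (inj₂ (inj₁ (true , ◁ , c , x)))      = upper x ◁ c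
decode (inj₂ (inj₁ (false , ◁ , c , x)))     = lower c ◁ x
decode (inj₂ (inj₂ (true , ◁ , c , x , y)))  = diagUpper x y ◁ c
decode (inj₂ (inj₂ (false , ◁ , c , x , y))) = diagLower c ◁ x y

decode∘encode : ∀ {n} (φ : Atomic n) → decode (encode φ) ≡ φ
decode∘encode (upper _ _ _)       = refl
decode∘encode (lower _ _ _)       = refl
decode∘encode (diagUpper _ _ _ _) = refl
decode∘encode (diagLower _ _ _ _) = refl
decode∘encode ⊤ᶜ                  = refl
decode∘encode ⊥ᶜ                  = refl

_≟ᶜ_ : ∀ {n} → DecidableEquality (Code n)
_≟ᶜ_ = Sum.≡-dec Bool._≟_ (Sum.≡-dec
  (Product.≡-dec Bool._≟_ (Product.≡-dec _≟ᴿ_ (Product.≡-dec ℕ._≟_ Fin._≟_)))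
  (Product.≡-dec Bool._≟_ (Product.≡-dec _≟ᴿ_ (Product.≡-dec ℕ._≟_ (Product.≡-dec Fin._≟_ Fin._≟_)))))

encode-injective : ∀ {n} {φ ψ : Atomic n} → encode φ ≡ encode ψ → φ ≡ ψ
encode-injective {φ = φ} {ψ} eq =
  trans (sym (decode∘encode φ)) (trans (cong decode eq) (decode∘encode ψ))

_≟ᴬ_ : ∀ {n} → DecidableEquality (Atomic n)
_≟ᴬ_ = via-injection (mk↣ encode-injective) _≟ᶜ_

∈-concatMap : {A B : Set} {f : A → List B} {xs : List A} {x : A} {y : B} →
  x ∈ xs → y ∈ f x → y ∈ concatMap f xs
∈-concatMap x∈xs y∈fx = ∈-concatMap⁺ _ (lose x∈xs y∈fx)

-- Enumeration of the constraints with a bounded constant.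

constant : ∀ {n} → Atomic n → ℕ
constant (upper _ _ c)       = c
constant (lower c _ _)       = c
constant (diagUpper _ _ _ c) = c
constant (diagLower c _ _ _) = c
constant ⊤ᶜ                  = 0
constant ⊥ᶜ                  = 0

rels : List Rel
rels = lt ∷ le ∷ []

∈-rels : ∀ ◁ → ◁ ∈ rels
∈-rels lt = here refl
∈-rels le = there (here refl)

bools : List Bool
bools = true ∷ false ∷ []

∈-bools : ∀ b → b ∈ bools
∈-bools true  = here refl
∈-bools false = there (here refl)

boundedCodes : {A : Set} → ℕ → List A → List (Bool × Rel × ℕ × A)
boundedCodes N xs =
  -- `upTo` stops before its argument, so `suc N` keeps `N` itself.
  cartesianProduct bools (cartesianProduct rels (cartesianProduct (upTo (suc N)) xs))

∈-boundedCodes : ∀ {A : Set} {N xs} b ◁ {c} {x : A} → c ≤ N → x ∈ xs →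
  (b , ◁ , c , x) ∈ boundedCodes N xs
∈-boundedCodes b ◁ c≤N x∈xs =
  ∈-cartesianProduct⁺ (∈-bools b) (∈-cartesianProduct⁺ (∈-rels ◁)
    (∈-cartesianProduct⁺ (∈-upTo⁺ (s≤s c≤N)) x∈xs))

module _ (n N : ℕ) where

  nonDiagonalCodes : List (Bool × Rel × ℕ × Fin n)
  nonDiagonalCodes = boundedCodes N (allFin n)

  diagonalCodes : List (Bool × Rel × ℕ × Fin n × Fin n)
  diagonalCodes = boundedCodes N (cartesianProduct (allFin n) (allFin n))

  atomicCodes : List (Code n)
  atomicCodes = map inj₁ bools ++ map inj₂ (map inj₁ nonDiagonalCodes ++ map inj₂ diagonalCodes)

  boundedAtomics : List (Atomic n)
  boundedAtomics = map decode atomicCodes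

  ∈-boundedAtomics : ∀ φ → constant φ ≤ N → φ ∈ boundedAtomics
  ∈-boundedAtomics φ c≤N =
    subst (_∈ boundedAtomics) (decode∘encode φ) (∈-map⁺ decode (encode∈ φ c≤N))
    where
    nonDiagonal∈ : ∀ b ◁ {c} x → c ≤ N → inj₂ (inj₁ (b , ◁ , c , x)) ∈ atomicCodes
    nonDiagonal∈ b ◁ x c≤N = ∈-++⁺ʳ (map inj₁ bools) (∈-map⁺ inj₂ (∈-++⁺ˡ
      (∈-map⁺ inj₁ (∈-boundedCodes b ◁ c≤N (∈-allFin x)))))

    diagonal∈ : ∀ b ◁ {c} x y → c ≤ N → inj₂ (inj₂ (b , ◁ , c , x , y)) ∈ atomicCodes
    diagonal∈ b ◁ x y c≤N = ∈-++⁺ʳ (map inj₁ bools) (∈-map⁺ inj₂ (∈-++⁺ʳ (map inj₁ nonDiagonalCodes)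
      (∈-map⁺ inj₂ (∈-boundedCodes b ◁ c≤N (∈-cartesianProduct⁺ (∈-allFin x) (∈-allFin y))))))

    encode∈ : ∀ φ → constant φ ≤ N → encode φ ∈ atomicCodes
    encode∈ (upper x ◁ c)       = nonDiagonal∈ true ◁ x
    encode∈ (lower c ◁ x)       = nonDiagonal∈ false ◁ x
    encode∈ (diagUpper x y ◁ c) = diagonal∈ true ◁ x y
    encode∈ (diagLower c ◁ x y) = diagonal∈ false ◁ x y
    encode∈ ⊤ᶜ _                = ∈-++⁺ˡ (∈-map⁺ inj₁ (∈-bools true))
    encode∈ ⊥ᶜ _                = ∈-++⁺ˡ (∈-map⁺ inj₁ (∈-bools false))

-- Constants under inverse updates and pruning.

module _ {n : ℕ} (N : ℕ) (g : Guard n) where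

  BoundedAbove : Fin n → Set
  BoundedAbove x = Any (UpperBound x) g

  -- When the constants of g are at most N, pre prunes every larger constant on a
  -- constraint about x or x - y for x bounded above in g.
  Tame : Pred (Atomic n) 0ℓ
  Tame (upper x ◁ c)       = c ≤ N ⊎ BoundedAbove x
  Tame (lower c ◁ x)       = c ≤ N ⊎ BoundedAbove x
  Tame (diagUpper x y ◁ c) = c ≤ N ⊎ BoundedAbove x
  Tame (diagLower c ◁ x y) = c ≤ N ⊎ BoundedAbove x
  Tame ⊤ᶜ                  = ⊤
  Tame ⊥ᶜ                  = ⊤

  tame-truth : ∀ a ◁ b → Tame (truth a ◁ b)
  tame-truth a lt b with a <? b
  ... | yes _ = _
  ... | no  _ = _
  tame-truth a le b with a ≤? b
  ... | yes _ = _
  ... | no  _ = _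

  tame-upperᶻ : ∀ x ◁ {c} → c ℤ.≤ + N ⊎ BoundedAbove x → Tame (upperᶻ x ◁ c)
  tame-upperᶻ x lt {+ zero}   _ = _
  tame-upperᶻ x lt {+ suc c}  (inj₁ (+≤+ c≤N)) = inj₁ c≤N
  tame-upperᶻ x lt {+ suc c}  (inj₂ b)         = inj₂ b
  tame-upperᶻ x le {+ c}      (inj₁ (+≤+ c≤N)) = inj₁ c≤N
  tame-upperᶻ x le {+ c}      (inj₂ b)         = inj₂ b
  tame-upperᶻ x lt { -[1+ _ ]} _ = _
  tame-upperᶻ x le { -[1+ _ ]} _ = _

  tame-lowerᶻ : ∀ x ◁ {c} → c ℤ.≤ + N ⊎ BoundedAbove x → Tame (lowerᶻ c ◁ x)
  tame-lowerᶻ x lt {+ c}      (inj₁ (+≤+ c≤N)) = inj₁ c≤N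
  tame-lowerᶻ x lt {+ c}      (inj₂ b)         = inj₂ b
  tame-lowerᶻ x le {+ zero}   _ = _
  tame-lowerᶻ x le {+ suc c}  (inj₁ (+≤+ c≤N)) = inj₁ c≤N
  tame-lowerᶻ x le {+ suc c}  (inj₂ b)         = inj₂ b
  tame-lowerᶻ x lt { -[1+ _ ]} _ = _
  tame-lowerᶻ x le { -[1+ _ ]} _ = _

  -- A negative constant swaps the clocks and is negated, so its absolute value has to be controlled
  -- through `y`, which then comes first.
  tame-diagUpperᶻ : ∀ x y ◁ {c} → c ℤ.≤ + N ⊎ BoundedAbove x → - c ℤ.≤ + N ⊎ BoundedAbove y →
    Tame (diagUpperᶻ x y ◁ c)
  tame-diagUpperᶻ x y ◁ {c} p q with x Fin.≟ y | c
  ... | yes _ | c        = tame-truth (+ 0) ◁ c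
  ... | no  _ | + d      = [ (λ { (+≤+ d≤N) → inj₁ d≤N }) , inj₂ ]′ p
  ... | no  _ | -[1+ d ] = [ (λ { (+≤+ d≤N) → inj₁ d≤N }) , inj₂ ]′ q

  tame-diagLowerᶻ : ∀ x y ◁ {c} → c ℤ.≤ + N ⊎ BoundedAbove x → - c ℤ.≤ + N ⊎ BoundedAbove y →
    Tame (diagLowerᶻ c ◁ x y)
  tame-diagLowerᶻ x y ◁ {c} p q with x Fin.≟ y | c
  ... | yes _ | c        = tame-truth c ◁ (+ 0)
  ... | no  _ | + d      = [ (λ { (+≤+ d≤N) → inj₁ d≤N }) , inj₂ ]′ p
  ... | no  _ | -[1+ d ] = [ (λ { (+≤+ d≤N) → inj₁ d≤N }) , inj₂ ]′ q

  -- Zero is kept apart because only a positive subtraction comes with an upper bound in the guard.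
  ResetOrBoundedSubtract : Update n → Fin n → Set
  ResetOrBoundedSubtract up x =
    up x ≡ const 0 ⊎ ∃[ c ] (up x ≡ x ⊕ (- (+ c)) × (c ≡ 0 ⊎ BoundedAbove x))

  -- With `x` decreased by `d` and the other clock by `e`, this is by unfolding the constant that
  -- `up⁻¹` leaves. Only `d` can push it above `c`, and a positive `d` forces `x` to be bounded
  -- above.
  subtract-tame : ∀ {x} c d {e} → c ≤ N → d ≡ 0 ⊎ BoundedAbove x →
    + c ℤ.- - (+ d) ℤ.- + e ℤ.≤ + N ⊎ BoundedAbove x
  subtract-tame c d {e} c≤N (inj₁ refl) rewrite ℕ.+-identityʳ c =
    inj₁ (ℤ.≤-trans (ℤ.i-j≤i (+ c) (+ e)) (+≤+ c≤N))
  subtract-tame c d c≤N (inj₂ b) = inj₂ b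

  -- The constant turns negative only through `e`: when `e` is zero, the negation is at most 0.
  neg-subtract-tame : ∀ {y} c d {e} → e ≡ 0 ⊎ BoundedAbove y →
    - (+ c ℤ.- - (+ d) ℤ.- + e) ℤ.≤ + N ⊎ BoundedAbove y
  neg-subtract-tame c d (inj₁ refl) rewrite ℤ.neg-involutive (+ d) = inj₁ ℤ.neg-≤-pos
  neg-subtract-tame c d (inj₂ b) = inj₂ b

  single-tame : ∀ {x} c d → c ≤ N → d ≡ 0 ⊎ BoundedAbove x →
    + c ℤ.- - (+ d) ℤ.≤ + N ⊎ BoundedAbove x
  single-tame c d c≤N p = subst (λ z → z ℤ.≤ + N ⊎ _) (ℤ.+-identityʳ _) (subtract-tame c d {0} c≤N p)

  module _ {up : Update n} (shape : ∀ x → ResetOrBoundedSubtract up x) where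

    -- In every case the clock whose subtraction raises the constant is the first clock of the
    -- resulting constraint, the one that `Tame` and the pruning look at.
    tame-⁻¹ : ∀ φ → constant φ ≤ N → Tame (up ⁻¹[ φ ])
    tame-⁻¹ (upper x ◁ c) c≤N with up x | shape x
    ... | _ | inj₁ refl           = tame-truth (+ 0) ◁ (+ c)
    ... | _ | inj₂ (d , refl , p) = tame-upperᶻ x ◁ (single-tame c d c≤N p)
    tame-⁻¹ (lower c ◁ x) c≤N with up x | shape x
    ... | _ | inj₁ refl           = tame-truth (+ c) ◁ (+ 0)
    ... | _ | inj₂ (d , refl , p) = tame-lowerᶻ x ◁ (single-tame c d c≤N p)
    tame-⁻¹ (diagUpper x y ◁ c) c≤N with up x | shape x | up y | shape y
    ... | _ | inj₁ refl           | _ | inj₁ refl           = tame-truth (+ 0) ◁ (+ c)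
    ... | _ | inj₂ (d , refl , p) | _ | inj₁ refl           = tame-upperᶻ x ◁ (subtract-tame c d {0} c≤N p)
    -- Resetting `x` leaves `e - c` as a lower bound on `y`, so the subtraction from `y` is now the
    -- one that raises the constant, starting from 0.
    ... | _ | inj₁ refl           | _ | inj₂ (e , refl , q) = tame-lowerᶻ y ◁ (subtract-tame 0 e z≤n q)
    ... | _ | inj₂ (d , refl , p) | _ | inj₂ (e , refl , q) =
      tame-diagUpperᶻ x y ◁ (subtract-tame c d c≤N p) (neg-subtract-tame c d q)
    tame-⁻¹ (diagLower c ◁ x y) c≤N with up x | shape x | up y | shape y
    ... | _ | inj₁ refl           | _ | inj₁ refl           = tame-truth (+ c) ◁ (+ 0)
    ... | _ | inj₂ (d , refl , p) | _ | inj₁ refl           = tame-lowerᶻ x ◁ (subtract-tame c d {0} c≤N p)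
    ... | _ | inj₁ refl           | _ | inj₂ (e , refl , q) = tame-upperᶻ y ◁ (subtract-tame 0 e z≤n q)
    ... | _ | inj₂ (d , refl , p) | _ | inj₂ (e , refl , q) =
      tame-diagLowerᶻ x y ◁ (subtract-tame c d c≤N p) (neg-subtract-tame c d q)
    tame-⁻¹ ⊤ᶜ _ = _
    tame-⁻¹ ⊥ᶜ _ = _

  module _ (g≤N : All (λ φ → constant φ ≤ N) g) where

    -- The bound on `x` in the guard has a constant at most `N`, hence below `d`.
    upperBelow⁺ : ∀ {x d} → BoundedAbove x → N < d → Any (UpperBelow x d) g
    upperBelow⁺ b N<d with find b
    ... | _ , φ∈g , upperBound {c = c} = lose φ∈g (upperBelow c (ℕ.≤-<-trans (All.lookup g≤N φ∈g) N<d))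

    diagPruned⁺ : ∀ {x y d} → BoundedAbove x → N < d → Any (DiagPruned x y d) g
    diagPruned⁺ b N<d = Any.map (λ { (upperBelow _ c<d) → byUpper c<d }) (upperBelow⁺ b N<d)

    selected≤ : ∀ {x d} (p : Any (UpperBelow x d) g) → selected p ≤ N
    -- `satisfied` forgets where its witness comes from, so the bound is proved by recursion on the
    -- position and abstracted together with the witness.
    selected≤ p with satisfied p | satisfied≤ g≤N p
      where
      satisfied≤ : ∀ {x d h} → All (λ φ → constant φ ≤ N) h → (p : Any (UpperBelow x d) h) →
        constant (proj₁ (satisfied p)) ≤ N
      satisfied≤ (c≤N All.∷ _) (here _)  = c≤N
      satisfied≤ (_ All.∷ cs)  (there p) = satisfied≤ cs p
    ... | _ , upperBelow _ _ | c≤N = c≤N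

    -- If the constant exceeds `N`, tameness bounds the first clock in the guard and a case of `pre`
    -- fires: upper and diagonal constraints become `⊤ᶜ`, lower ones take over a guard constant,
    -- whichever conjunct is selected.
    pre≤ : ∀ sel φ up → Tame (up ⁻¹[ φ ]) → constant (pre sel φ g up) ≤ N
    pre≤ sel φ up t with up ⁻¹[ φ ]
    pre≤ sel φ up t | upper x ◁ d with any? (upperBound? x) g
    ... | yes _ = z≤n
    ... | no ¬b = [ (λ d≤N → d≤N) , (λ b → contradiction b ¬b) ]′ t
    pre≤ sel φ up t | diagUpper x y ◁ d with any? (diagPruned? x y d) g
    ... | yes _ = z≤n
    ... | no ¬p = [ (λ d≤N → d≤N) , (λ b → ℕ.≮⇒≥ (¬p ∘ diagPruned⁺ b)) ]′ t
    pre≤ sel φ up t | diagLower d ◁ x y with any? (diagPruned? x y d) g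
    ... | yes _ = z≤n
    ... | no ¬p = [ (λ d≤N → d≤N) , (λ b → ℕ.≮⇒≥ (¬p ∘ diagPruned⁺ b)) ]′ t
    pre≤ sel φ up t | ⊤ᶜ = z≤n
    pre≤ sel φ up t | ⊥ᶜ = z≤n
    pre≤ sel φ up t | lower d ◁ x with any? (upperBelow? x d) g
    ... | yes p = selected≤ (sel φ g up x d p)
    ... | no ¬p = [ (λ d≤N → d≤N) , (λ b → ℕ.≮⇒≥ (¬p ∘ upperBelow⁺ b)) ]′ t

-- Saturation inside a finite cover.

module _ {A : Set} (_≟_ : DecidableEquality A) {P : Pred A 0ℓ} (next : List A → List A)
  (next⁺ : ∀ {xs} → All P xs → All P (next xs)) where

  open DecMembership _≟_ using (_∈?_)

  -- Membership in `P` is never tested: elements enter the list only through `next`, which preserves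
  -- `P`. Each round takes one new element out of the finite cover, so a closed list is reached.
  saturate : ∀ us → (∀ {x} → P x → x ∈ us) → ∃[ xs ] All P xs × All (_∈ xs) (next xs)
  saturate us P⊆us = go [] us All.[] (inj₂ ∘ P⊆us) (<-wellFounded _)
    where
    -- `us` keeps the candidates not yet listed; its length is the decreasing measure.
    go : ∀ xs us → All P xs → (∀ {x} → P x → x ∈ xs ⊎ x ∈ us) → Acc _<_ (length us) →
      ∃[ xs ] All P xs × All (_∈ xs) (next xs)
    go xs us Pxs cover (acc rec) with all? (_∈? xs) (next xs)
    ... | yes closed = xs , Pxs , closed
    ... | no ¬closed with find (All.¬All⇒Any¬ (_∈? xs) (next xs) ¬closed)
    ... | y , y∈next , y∉xs =
      go (y ∷ xs) (filter (λ u → ¬? (u ≟ y)) us) (Py All.∷ Pxs) cover′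
        (rec (filter-notAll _ us (lose y∈us (λ y≢y → y≢y refl))))
      where
      Py : P y
      Py = All.lookup (next⁺ Pxs) y∈next

      y∈us : y ∈ us
      y∈us = [ (λ y∈xs → contradiction y∈xs y∉xs) , (λ y∈us → y∈us) ]′ (cover Py)

      cover′ : ∀ {x} → P x → x ∈ y ∷ xs ⊎ x ∈ filter (λ u → ¬? (u ≟ y)) us
      cover′ {x} Px with x ≟ y | cover Px
      ... | yes x≡y | _         = inj₁ (here x≡y)
      ... | no  _   | inj₁ x∈xs = inj₁ (there x∈xs)
      ... | no  x≢y | inj₂ x∈us = inj₂ (∈-filter⁺ _ x∈us x≢y)

-- Listing a smallest map with bounded constants.

module _ (𝒜 : UTA) (sel : Selection (UTA.clocks 𝒜)) (G : ConstraintMap 𝒜)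
  (G-smallest : IsSmallestReducedMap 𝒜 sel G) where

  open UTA 𝒜
  open Transition
  open IsSmallestReducedMap G-smallest

  -- Propagation moves constraints between states, so saturation has to run over all states at once.
  Located : Set
  Located = Fin states × Atomic clocks

  InG : Pred Located 0ℓ
  InG = uncurry G

  _≟ᴸ_ : DecidableEquality Located
  _≟ᴸ_ = Product.≡-dec Fin._≟_ _≟ᴬ_

  preᵗ : Transition states clocks → Atomic clocks → Atomic clocks
  preᵗ t φ = pre sel φ (guard t) (update t)

  atTarget? : (t : Transition states clocks) → Decidable (λ (qφ : Located) → proj₁ qφ ≡ target t)
  atTarget? t (q , _) = q Fin.≟ target t

  contributions : List Located → Transition states clocks → List (Atomic clocks)
  contributions xs t = guard t ++
    map (λ x → preᵗ t (lower 0 le x)) (allFin clocks) ++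
    map (λ (_ , φ) → preᵗ t φ) (filter (atTarget? t) xs)

  next : List Located → List Located
  next xs = concatMap (λ t → map (source t ,_) (contributions xs t)) transitions

  next⁺ : ∀ {xs} → All InG xs → All InG (next xs)
  next⁺ {xs} Gxs = All.concat⁺ (All.map⁺ (All.tabulate λ {t} t∈T → All.map⁺
    (All.++⁺ (All.tabulate (R.guards t∈T))
    (All.++⁺ (All.map⁺ (All.tabulate λ {x} _ → R.nonNegative t∈T x))
             (All.map⁺ (All.tabulate λ ψ∈ → propagated t∈T (∈-filter⁻ (atTarget? t) {xs = xs} ψ∈)))))))
    where
    module R = IsReducedMap isReduced

    propagated : ∀ {t} → t ∈ transitions → ∀ {qψ} → qψ ∈ xs × proj₁ qψ ≡ target t →
      G (source t) (preᵗ t (proj₂ qψ))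
    propagated t∈T (ψ∈xs , refl) = R.propagates t∈T (All.lookup Gxs ψ∈xs)

  -- The three blocks of `contributions` match the three closure conditions. This makes the
  -- minimality of `G` applicable to a saturated list.
  closed⇒isReduced : ∀ {xs} → All (_∈ xs) (next xs) → IsReducedMap 𝒜 sel (λ q φ → (q , φ) ∈ xs)
  closed⇒isReduced {xs} closed = record
    { guards      = λ t∈T φ∈g → close t∈T (∈-++⁺ˡ φ∈g)
    ; nonNegative = λ {t} t∈T x → close t∈T (∈-++⁺ʳ (guard t) (∈-++⁺ˡ (∈-map⁺ _ (∈-allFin x))))
    ; propagates  = λ {t} t∈T φ∈xs → close t∈T (∈-++⁺ʳ (guard t)
        (∈-++⁺ʳ (map _ (allFin clocks)) (∈-map⁺ _ (∈-filter⁺ (atTarget? t) φ∈xs refl))))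
    }
    where
    close : ∀ {t φ} → t ∈ transitions → φ ∈ contributions xs t → (source t , φ) ∈ xs
    close t∈T φ∈ = All.lookup closed (∈-concatMap t∈T (∈-map⁺ _ φ∈))

  -- Saturation gives a closed list of members of `G`, and by minimality it contains all of `G`.
  -- Membership in this list therefore decides `G q` among the bounded constraints.
  bounded⇒finite : ∀ N → (∀ {q φ} → G q φ → constant φ ≤ N) → ∀ q → Finite (G q)
  bounded⇒finite N G≤N q with saturate _≟ᴸ_ next next⁺
    (cartesianProduct (allFin states) (boundedAtomics clocks N))
    (λ {(q , φ)} Gqφ → ∈-cartesianProduct⁺ (∈-allFin q) (∈-boundedAtomics clocks N φ (G≤N Gqφ)))
  ... | xs , Gxs , closed = filter ∈xs? (boundedAtomics clocks N) , λ φ → mk⇔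
    (λ Gφ → ∈-filter⁺ ∈xs? (∈-boundedAtomics clocks N φ (G≤N Gφ)) (smallest (closed⇒isReduced closed) q Gφ))
    (λ φ∈ → All.lookup Gxs (proj₂ (∈-filter⁻ ∈xs? {xs = boundedAtomics clocks N} φ∈)))
    where
    ∈xs? : Decidable (λ φ → (q , φ) ∈ xs)
    ∈xs? φ = (q , φ) ∈? xs
      where open DecMembership _≟ᴸ_ using (_∈?_)

-- The bound on constants for syntactically bounded subtraction.

module _ (𝒜 : UTA) (bs : HasSyntacticallyBoundedSubtraction 𝒜) where

  open UTA 𝒜
  open Transition
  open HasSyntacticallyBoundedSubtraction bs
  open IsTimedAutomatonWithSubtraction isTimedAutomatonWithSubtraction

  guardConstants : List ℕ
  guardConstants = concatMap (λ t → map constant (guard t)) transitions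

  maxConstant : ℕ
  maxConstant = max 0 guardConstants

  guard≤ : ∀ {t} → t ∈ transitions → All (λ φ → constant φ ≤ maxConstant) (guard t)
  guard≤ t∈T = All.tabulate λ φ∈g →
    All.lookup (xs≤max 0 guardConstants) (∈-concatMap t∈T (∈-map⁺ constant φ∈g))

  resetOrBoundedSubtract : ∀ {t} → t ∈ transitions → ∀ x →
    ResetOrBoundedSubtract maxConstant (guard t) (update t) x
  resetOrBoundedSubtract t∈T x with resetOrSubtract t∈T x
  ... | inj₁ reset             = inj₁ reset
  -- Subtracting 0 carries no guard bound, but it cannot raise a constant either.
  ... | inj₂ (zero , eq)       = inj₂ (0 , eq , inj₁ refl)
  ... | inj₂ (suc c , eq) with bounded t∈T x (suc c) (s≤s z≤n) eq
  ...   | _ , _ , φ∈g = inj₂ (suc c , eq , inj₂ (lose φ∈g upperBound))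

  -- One bound serves all states, being a maximum over all transitions. The constraints `0 ≤ x`
  -- start from constant 0, and `tame-⁻¹` followed by `pre≤` never leaves the bound.
  bounded-isReduced : ∀ sel → IsReducedMap 𝒜 sel (λ _ φ → constant φ ≤ maxConstant)
  bounded-isReduced sel = record
    { guards      = λ t∈T → All.lookup (guard≤ t∈T)
    ; nonNegative = λ t∈T x → pre-bounded t∈T (lower 0 le x) z≤n
    ; propagates  = λ t∈T {φ} → pre-bounded t∈T φ
    }
    where
    pre-bounded : ∀ {t} → t ∈ transitions → ∀ φ → constant φ ≤ maxConstant →
      constant (pre sel φ (guard t) (update t)) ≤ maxConstant
    pre-bounded {t} t∈T φ φ≤N = pre≤ maxConstant (guard t) (guard≤ t∈T) sel φ (update t)
      (tame-⁻¹ maxConstant (guard t) (resetOrBoundedSubtract t∈T) φ φ≤N)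

theorem16 : (𝒜 : UTA) → HasSyntacticallyBoundedSubtraction 𝒜 →
    (sel : Selection (UTA.clocks 𝒜)) (G : ConstraintMap 𝒜) → IsSmallestReducedMap 𝒜 sel G →
    ∀ q → Finite (G q)
-- Minimality places `G` inside the reduced map of bounded constraints, which bounds its constants.
theorem16 𝒜 bs sel G G-smallest = bounded⇒finite 𝒜 sel G G-smallest (maxConstant 𝒜 bs)
  (IsSmallestReducedMap.smallest G-smallest (bounded-isReduced 𝒜 bs sel) _)
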